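{- In MLTT°, if $\vdash M:A$ (i.e. $M$ has type $A$ in the empty context), then either $M$ is an abstraction (of the form $\lambda_{x:B}N$), a product (of the form $\Pi_{x:B}C$), or the universe $\mathcal{U}$, or there is a term $M'$ with $M\rightsquigarrow M'$ (one step of head reduction).
   Context: MLTT° is the following type theory (dependent products and one universe with type-in-type). Terms are $M,N,A,B ::= x \mid \mathcal{U} \mid \Pi_{x:A}B \mid \lambda_{x:A}M \mid M\,N$, up to $\alpha$-equivalence, with capture-avoiding substitution $M[N/x]$. Contexts are finite lists of declarations $x:A$. The judgements $\vdash\Gamma$ (well-formed context), $\Gamma\vdash M:A$ (typing) and $\Gamma\vdash M\equiv N:A$ (definitional equality) are mutually inductively generated by the following rules. Contexts: the empty context is well-formed; if $\vdash\Gamma$ and $\Gamma\vdash A:\mathcal{U}$ then $\vdash\Gamma,x:A$ ($x$ fresh). Typing: (Var) if $\vdash\Gamma$ and $(x:A)\in\Gamma$ then $\Gamma\vdash x:A$. (Univ) if $\vdash\Gamma$ then $\Gamma\vdash\mathcal{U}:\mathcal{U}$. (Pi) if $\Gamma\vdash A:\mathcal{U}$ and $\Gamma,x:A\vdash B:\mathcal{U}$ then $\Gamma\vdash\Pi_{x:A}B:\mathcal{U}$. (Lam) if $\Gamma\vdash A:\mathcal{U}$ and $\Gamma,x:A\vdash M:B$ then $\Gamma\vdash\lambda_{x:A}M:\Pi_{x:A}B$. (App) if $\Gamma\vdash M:\Pi_{x:A}B$ and $\Gamma\vdash N:A$ then $\Gamma\vdash M\,N:B[N/x]$. (Conv) if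 $\Gamma\vdash M:A$ and $\Gamma\vdash A\equiv B:\mathcal{U}$ then $\Gamma\vdash M:B$. Definitional equality: reflexivity on well-typed terms, symmetry, transitivity; conversion (if $\Gamma\vdash M\equiv N:A$ and $\Gamma\vdash A\equiv B:\mathcal{U}$ then $\Gamma\vdash M\equiv N:B$); congruence rules for $\Pi$, $\lambda$ and application; ($\beta$) if $\Gamma\vdash A:\mathcal{U}$, $\Gamma,x:A\vdash M:B$ and $\Gamma\vdash N:A$ then $\Gamma\vdash(\lambda_{x:A}M)\,N\equiv M[N/x]:B[N/x]$; ($\eta$) if $\Gamma\vdash M:\Pi_{x:A}B$, $\Gamma\vdash N:\Pi_{x:A}B$ and $\Gamma,x:A\vdash M\,x\equiv N\,x:B$ ($x$ fresh) then $\Gamma\vdash M\equiv N:\Pi_{x:A}B$. Head reduction: one-step head reduction $M\rightsquigarrow M'$ on (untyped) terms is generated by $(\lambda_{x:A}M)\,N\rightsquigarrow M[N/x]$ and: if $M\rightsquigarrow M'$ then $M\,N\rightsquigarrow M'\,N$. -}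

module Defs where

open import Data.Fin.Base using (Fin; zero; suc)
open import Data.Fin.Substitution using (Sub; Lift; TermSubst)
open import Data.Nat.Base using (ℕ; zero; suc)
open import Data.Vec.Base using (lookup)

infixl 9 _·_
infixl 5 _▹_
infix 4 ⊢_ _∋_∶_ _⊢_∶_ _⊢_≐_∶_ _⇝_

-- Terms up to α-equivalence are represented by well-scoped de Bruijn terms:
-- Tm n is the set of terms with at most n free variables. The second argument
-- of Π and of ƛ lies under one binder (index zero).
data Tm (n : ℕ) : Set where
  var : (x : Fin n) → Tm n
  U   : Tm n
  Π   : (A : Tm n) (B : Tm (suc n)) → Tm n
  ƛ   : (A : Tm n) (M : Tm (suc n)) → Tm n
  _·_ : (M N : Tm n) → Tm n

module TmApp {T : ℕ → Set} (l : Lift T Tm) where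
  open Lift l hiding (var)

  infixl 8 _/_

  _/_ : ∀ {m n} → Tm m → Sub T m n → Tm n
  var x   / ρ = lift (lookup ρ x)
  U       / ρ = U
  Π A B   / ρ = Π (A / ρ) (B / ρ ↑)
  ƛ A M   / ρ = ƛ (A / ρ) (M / ρ ↑)
  (M · N) / ρ = (M / ρ) · (N / ρ)

tmSubst : TermSubst Tm
tmSubst = record { var = var ; app = TmApp._/_ }

open TermSubst tmSubst public using (_/_; sub; weaken)

-- M [ N ] is M[N/x], where x is the variable with index zero.
infixl 10 _[_]

_[_] : ∀ {n} → Tm (suc n) → Tm n → Tm n
M [ N ] = M / sub N

data Ctx : ℕ → Set where
  ∅   : Ctx zero
  _▹_ : ∀ {n} (Γ : Ctx n) (A : Tm n) → Ctx (suc n)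

-- In Γ ▹ A, the type A lives over Γ, so looking it up in an extension of Γ
-- weakens it once for every declaration passed.
data _∋_∶_ : ∀ {n} → Ctx n → Fin n → Tm n → Set where
  here  : ∀ {n} {Γ : Ctx n} {A} → Γ ▹ A ∋ zero ∶ weaken A
  there : ∀ {n} {Γ : Ctx n} {x A B} → Γ ∋ x ∶ A → Γ ▹ B ∋ suc x ∶ weaken A

data ⊢_ : ∀ {n} → Ctx n → Set
data _⊢_∶_ : ∀ {n} → Ctx n → Tm n → Tm n → Set
data _⊢_≐_∶_ : ∀ {n} → Ctx n → Tm n → Tm n → Tm n → Set

data ⊢_ where
  ⊢∅ : ⊢ ∅
  ⊢▹ : ∀ {n} {Γ : Ctx n} {A} → ⊢ Γ → Γ ⊢ A ∶ U → ⊢ Γ ▹ A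

data _⊢_∶_ where
  ⊢var  : ∀ {n} {Γ : Ctx n} {x A} →
          ⊢ Γ → Γ ∋ x ∶ A → Γ ⊢ var x ∶ A
  ⊢U    : ∀ {n} {Γ : Ctx n} →
          ⊢ Γ → Γ ⊢ U ∶ U
  ⊢Π    : ∀ {n} {Γ : Ctx n} {A B} →
          Γ ⊢ A ∶ U → Γ ▹ A ⊢ B ∶ U → Γ ⊢ Π A B ∶ U
  ⊢ƛ    : ∀ {n} {Γ : Ctx n} {A B M} →
          Γ ⊢ A ∶ U → Γ ▹ A ⊢ M ∶ B → Γ ⊢ ƛ A M ∶ Π A B
  ⊢·    : ∀ {n} {Γ : Ctx n} {A B M N} →
          Γ ⊢ M ∶ Π A B → Γ ⊢ N ∶ A → Γ ⊢ M · N ∶ B [ N ]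
  ⊢conv : ∀ {n} {Γ : Ctx n} {A B M} →
          Γ ⊢ M ∶ A → Γ ⊢ A ≐ B ∶ U → Γ ⊢ M ∶ B

data _⊢_≐_∶_ where
  ≐refl  : ∀ {n} {Γ : Ctx n} {A M} →
           Γ ⊢ M ∶ A → Γ ⊢ M ≐ M ∶ A
  ≐sym   : ∀ {n} {Γ : Ctx n} {A M N} →
           Γ ⊢ M ≐ N ∶ A → Γ ⊢ N ≐ M ∶ A
  ≐trans : ∀ {n} {Γ : Ctx n} {A M N P} →
           Γ ⊢ M ≐ N ∶ A → Γ ⊢ N ≐ P ∶ A → Γ ⊢ M ≐ P ∶ A
  ≐conv  : ∀ {n} {Γ : Ctx n} {A B M N} →
           Γ ⊢ M ≐ N ∶ A → Γ ⊢ A ≐ B ∶ U → Γ ⊢ M ≐ N ∶ B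
  ≐Π     : ∀ {n} {Γ : Ctx n} {A A′ B B′} →
           Γ ⊢ A ≐ A′ ∶ U → Γ ▹ A ⊢ B ≐ B′ ∶ U →
           Γ ⊢ Π A B ≐ Π A′ B′ ∶ U
  ≐ƛ     : ∀ {n} {Γ : Ctx n} {A A′ B M M′} →
           Γ ⊢ A ≐ A′ ∶ U → Γ ▹ A ⊢ M ≐ M′ ∶ B →
           Γ ⊢ ƛ A M ≐ ƛ A′ M′ ∶ Π A B
  ≐·     : ∀ {n} {Γ : Ctx n} {A B M M′ N N′} →
           Γ ⊢ M ≐ M′ ∶ Π A B → Γ ⊢ N ≐ N′ ∶ A →
           Γ ⊢ M · N ≐ M′ · N′ ∶ B [ N ]
  ≐β     : ∀ {n} {Γ : Ctx n} {A B M N} →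
           Γ ⊢ A ∶ U → Γ ▹ A ⊢ M ∶ B → Γ ⊢ N ∶ A →
           Γ ⊢ ƛ A M · N ≐ M [ N ] ∶ B [ N ]
  -- Weakening M and N makes the bound variable fresh for both.
  ≐η     : ∀ {n} {Γ : Ctx n} {A B M N} →
           Γ ⊢ M ∶ Π A B → Γ ⊢ N ∶ Π A B →
           Γ ▹ A ⊢ weaken M · var zero ≐ weaken N · var zero ∶ B →
           Γ ⊢ M ≐ N ∶ Π A B

data _⇝_ {n : ℕ} : Tm n → Tm n → Set where
  ⇝β : ∀ {A M N} → ƛ A M · N ⇝ M [ N ]
  ⇝· : ∀ {M M′ N} → M ⇝ M′ → M · N ⇝ M′ · N

-- Conversion is sound for an extensional filter model of the λ-calculus which
-- ignores annotations and interprets U by the empty set and every product by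
-- the set of all intersection types. Hence no product is convertible to U, so
-- neither U nor a product has a product type, and the head of a closed
-- application is an abstraction or reduces.
module Submission where

open import Defs
open import Data.Empty using (⊥; ⊥-elim)
open import Data.Fin.Base using (Fin; zero; suc)
open import Data.Fin.Substitution using (Sub; Lift; TermSubst; module VarSubst)
open import Data.Fin.Substitution.Lemmas using (module VarLemmas)
open import Data.List.Base using (List; []; _∷_; _++_)
open import Data.List.Membership.Propositional using (lose)
open import Data.List.Relation.Unary.All as All using (All; []; _∷_)
open import Data.List.Relation.Unary.All.Properties using (++⁺)
open import Data.List.Relation.Unary.Any as Any using (Any; here; there)
open import Data.List.Relation.Unary.Any.Properties using (++⁺ˡ; ++⁺ʳ)
open import Data.Nat.Base using (ℕ; suc)
open import Data.Product.Base using (_×_; _,_; proj₁; proj₂; ∃; ∃₂)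
open import Data.Sum.Base using (_⊎_; inj₁; inj₂)
open import Data.Unit.Base using (⊤; tt)
open import Data.Vec.Base using (lookup)
open import Data.Vec.Functional using (Vector) renaming (_∷_ to _◂_)
open import Data.Vec.Properties using (lookup-map)
open import Function.Base using (_∘_; id)
open import Level using (0ℓ)
open import Relation.Binary.Definitions using (_Respects_)
open import Relation.Binary.PropositionalEquality.Core using (_≡_; refl; trans; cong)
open import Relation.Nullary.Negation.Core using (¬_)
open import Relation.Unary using (Pred; _⊆_) renaming (_≐_ to _≃_)
open import Relation.Unary.Properties
  using () renaming (≐-refl to ≃-refl; ≐-sym to ≃-sym; ≐-trans to ≃-trans)

open TermSubst tmSubst using (termLift; varLift) renaming (id to idₛ)

private
  variable
    n m : ℕ

-- Intersection types and subtyping.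

infixr 6 _⇒_
infix  4 _≤_
infix  7 ↑_

-- as ⇒ b stands for (⋂ as) → b, and _≤_ below is subtyping.
data Ty : Set where
  o   : Ty
  _⇒_ : (as : List Ty) (b : Ty) → Ty

-- The atom o is identified with [] ⇒ o, which makes the model extensional.
dom : Ty → List Ty
dom o        = []
dom (as ⇒ b) = as

cod : Ty → Ty
cod o        = o
cod (as ⇒ b) = b

-- Reading both sides through `dom` and `cod` gives `o ≤ [] ⇒ o` and its converse; `o≤o` is the base
-- on which such derivations rest.
data _≤_ : Ty → Ty → Set where
  o≤o : o ≤ o
  arr : ∀ {c d} → All (λ a → Any (_≤ a) (dom d)) (dom c) → cod c ≤ cod d → c ≤ d

-- The principal filter of `⋂ as`: a type that is not itself an intersection lies above `⋂ as`
-- exactly when it lies above one conjunct.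
↑_ : List Ty → Pred Ty 0ℓ
(↑ as) a = Any (_≤ a) as

mutual
  ≤-refl : ∀ {a} → a ≤ a
  ≤-refl {o}      = o≤o
  ≤-refl {as ⇒ b} = arr (⊆-↑ as) (≤-refl {b})

  ⊆-↑ : ∀ as → All (↑ as) as
  ⊆-↑ as = All.tabulate λ a∈as → lose a∈as (All.lookup (≤-refls as) a∈as)

  ≤-refls : ∀ as → All (λ a → a ≤ a) as
  ≤-refls []       = []
  ≤-refls (a ∷ as) = ≤-refl ∷ ≤-refls as

mutual
  -- Contravariance composes the domain parts in the opposite order, so the two derivations swap
  -- roles, but both get smaller.
  ≤-trans : ∀ {a b c} → a ≤ b → b ≤ c → a ≤ c
  ≤-trans o≤o       b≤c       = b≤c
  ≤-trans (arr p q) o≤o       = arr p q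
  ≤-trans (arr p q) (arr r s) = arr (↑-transs p r) (≤-trans q s)

  ↑-transs : ∀ {as bs cs} → All (↑ bs) as → All (↑ cs) bs → All (↑ cs) as
  ↑-transs []       qs = []
  ↑-transs (p ∷ ps) qs = ↑-trans p qs ∷ ↑-transs ps qs

  ↑-trans : ∀ {a bs cs} → (↑ bs) a → All (↑ cs) bs → (↑ cs) a
  ↑-trans (here b≤a) (q ∷ qs) = ↑-resp b≤a q
  ↑-trans (there p)  (q ∷ qs) = ↑-trans p qs

  ↑-resp : ∀ {as} → (↑ as) Respects _≤_
  ↑-resp a≤b (here p)  = here (≤-trans p a≤b)
  ↑-resp a≤b (there p) = there (↑-resp a≤b p)

-- The filter interpretation.

Env : ℕ → Set₁
Env n = Vector (Pred Ty 0ℓ) n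

-- Membership of `d` is derivability of `d` for the term in an intersection type system.
⟦_⟧ : Tm n → Env n → Pred Ty 0ℓ
⟦ var x ⟧ ρ   = ρ x
⟦ U ⟧     ρ d = ⊥
⟦ Π A B ⟧ ρ d = ⊤
⟦ ƛ A M ⟧ ρ d = ⟦ M ⟧ (↑ dom d ◂ ρ) (cod d)
⟦ M · N ⟧ ρ d = ∃ λ as → ⟦ M ⟧ ρ (as ⇒ d) × All (⟦ N ⟧ ρ) as

◂-mono : ∀ {P Q} {ρ σ : Env n} → P ⊆ Q → (∀ x → ρ x ⊆ σ x) → ∀ x → (P ◂ ρ) x ⊆ (Q ◂ σ) x
◂-mono P⊆Q ρ⊆σ zero    = P⊆Q
◂-mono P⊆Q ρ⊆σ (suc x) = ρ⊆σ x

⟦_⟧-mono : ∀ (M : Tm n) {ρ σ} → (∀ x → ρ x ⊆ σ x) → ⟦ M ⟧ ρ ⊆ ⟦ M ⟧ σ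
⟦ var x ⟧-mono ρ⊆σ = ρ⊆σ x
⟦ Π A B ⟧-mono ρ⊆σ = id
⟦ ƛ A M ⟧-mono ρ⊆σ = ⟦ M ⟧-mono (◂-mono id ρ⊆σ)
⟦ M · N ⟧-mono ρ⊆σ (as , p , ps) = as , ⟦ M ⟧-mono ρ⊆σ p , All.map (⟦ N ⟧-mono ρ⊆σ) ps

⟦_⟧-cong : ∀ (M : Tm n) {ρ σ} → (∀ x → ρ x ≃ σ x) → ⟦ M ⟧ ρ ≃ ⟦ M ⟧ σ
⟦ M ⟧-cong ρ≃σ = ⟦ M ⟧-mono (proj₁ ∘ ρ≃σ) , ⟦ M ⟧-mono (proj₂ ∘ ρ≃σ)

UpClosed : Env n → Set
UpClosed ρ = ∀ x → ρ x Respects _≤_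

◂-upClosed : ∀ {as} {ρ : Env n} → UpClosed ρ → UpClosed (↑ as ◂ ρ)
◂-upClosed ρ-up zero    = ↑-resp
◂-upClosed ρ-up (suc x) = ρ-up x

-- For an abstraction, `c ≤ d` places `↑ dom c` inside `↑ dom d`, so monotonicity absorbs the change
-- of domain.
⟦_⟧-resp : ∀ (M : Tm n) {ρ} → UpClosed ρ → ⟦ M ⟧ ρ Respects _≤_
⟦ var x ⟧-resp ρ-up = ρ-up x
⟦ Π A B ⟧-resp ρ-up _ = id
⟦ ƛ A M ⟧-resp ρ-up o≤o = id
⟦ ƛ A M ⟧-resp ρ-up (arr p q) r =
  ⟦ M ⟧-resp (◂-upClosed ρ-up) q (⟦ M ⟧-mono (◂-mono (λ a → ↑-trans a p) λ _ → id) r)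
⟦ M · N ⟧-resp ρ-up c≤d (as , p , ps) = as , ⟦ M ⟧-resp ρ-up (arr (⊆-↑ as) c≤d) p , ps

-- Continuity.

FinEnv : ℕ → Set
FinEnv n = Vector (List Ty) n

_Approximates_ : FinEnv n → Env n → Set
F Approximates ρ = ∀ x → All (ρ x) (F x)

_⊔_ : FinEnv n → FinEnv n → FinEnv n
(F ⊔ G) x = F x ++ G x

-- Scott continuity: each type in the value is already forced by finitely many types of each
-- variable.
Continuous : (Env n → Pred Ty 0ℓ) → Set₁
Continuous f = ∀ {ρ d} → f ρ d → ∃ λ F → F Approximates ρ × f (↑_ ∘ F) d

var-continuous : ∀ (x : Fin n) → Continuous (λ ρ → ρ x)
var-continuous zero {d = d} p =
  (d ∷ []) ◂ (λ _ → []) , (λ { zero → p ∷ [] ; (suc x) → [] }) , here ≤-refl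
var-continuous (suc x) {ρ} p with F , F≈ρ , q ← var-continuous x {ρ ∘ suc} p =
  [] ◂ F , (λ { zero → [] ; (suc y) → F≈ρ y }) , q

All-continuous : ∀ (M : Tm n) → Continuous ⟦ M ⟧ → ∀ {ρ as} → All (⟦ M ⟧ ρ) as →
                 ∃ λ F → F Approximates ρ × All (⟦ M ⟧ (↑_ ∘ F)) as
All-continuous M cont []       = (λ _ → []) , (λ _ → []) , []
All-continuous M cont (p ∷ ps)
  with F , F≈ρ , q ← cont p | G , G≈ρ , qs ← All-continuous M cont ps =
  F ⊔ G , (λ x → ++⁺ (F≈ρ x) (G≈ρ x)) ,
  ⟦ M ⟧-mono (λ x → ++⁺ˡ) q ∷ All.map (⟦ M ⟧-mono λ x → ++⁺ʳ (F x)) qs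

⟦_⟧-continuous : ∀ (M : Tm n) → Continuous ⟦ M ⟧
⟦ var x ⟧-continuous p = var-continuous x p
⟦ Π A B ⟧-continuous p = (λ _ → []) , (λ _ → []) , tt
⟦ ƛ A M ⟧-continuous p with F , F≈ρ , q ← ⟦ M ⟧-continuous p =
  -- The part of `F` at the bound variable lies in `↑ dom d`, so that filter can replace it.
  F ∘ suc , F≈ρ ∘ suc ,
  ⟦ M ⟧-mono (λ { zero a → ↑-trans a (F≈ρ zero) ; (suc x) → id }) q
⟦ M · N ⟧-continuous (as , p , ps)
  with F , F≈ρ , q ← ⟦ M ⟧-continuous p
     | G , G≈ρ , qs ← All-continuous N ⟦ N ⟧-continuous ps =
  F ⊔ G , (λ x → ++⁺ (F≈ρ x) (G≈ρ x)) ,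
  as , ⟦ M ⟧-mono (λ x → ++⁺ˡ) q , All.map (⟦ N ⟧-mono λ x → ++⁺ʳ (F x)) qs

-- Substitution, β and η in the model.

ƛ-cong : ∀ {A B} (M : Tm (suc m)) (N : Tm (suc n)) {ρ σ} →
         (∀ as → ⟦ M ⟧ (↑ as ◂ ρ) ≃ ⟦ N ⟧ (↑ as ◂ σ)) → ⟦ ƛ A M ⟧ ρ ≃ ⟦ ƛ B N ⟧ σ
ƛ-cong M N M≃N = (λ {d} → proj₁ (M≃N (dom d))) , (λ {d} → proj₂ (M≃N (dom d)))

·-cong : ∀ (M N : Tm m) (M′ N′ : Tm n) {ρ σ} → ⟦ M ⟧ ρ ≃ ⟦ M′ ⟧ σ → ⟦ N ⟧ ρ ≃ ⟦ N′ ⟧ σ →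
         ⟦ M · N ⟧ ρ ≃ ⟦ M′ · N′ ⟧ σ
·-cong M N M′ N′ (p , p′) (q , q′) =
  (λ (as , r , rs) → as , p  r , All.map q  rs) ,
  (λ (as , r , rs) → as , p′ r , All.map q′ rs)

≡⇒≃ : ∀ {P Q : Pred Ty 0ℓ} → P ≡ Q → P ≃ Q
≡⇒≃ refl = ≃-refl

module _ {T : ℕ → Set} (l : Lift T Tm) where
  open Lift l using (lift; _↑) renaming (var to varₜ; weaken to weakenₜ)
  open TmApp l renaming (_/_ to _/ₜ_)

  module _
    (⟦var0⟧   : ∀ {n} (ρ : Env n) P → ⟦ lift (varₜ zero) ⟧ (P ◂ ρ) ≃ P)
    (⟦weaken⟧ : ∀ {n} (t : T n) ρ P → ⟦ lift (weakenₜ t) ⟧ (P ◂ ρ) ≃ ⟦ lift t ⟧ ρ)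
    where

    ⟦↑⟧ : (σ : Sub T m n) (ρ : Env n) (P : Pred Ty 0ℓ) → ∀ x →
          ⟦ lift (lookup (σ ↑) x) ⟧ (P ◂ ρ) ≃ (P ◂ λ y → ⟦ lift (lookup σ y) ⟧ ρ) x
    ⟦↑⟧ σ ρ P zero    = ⟦var0⟧ ρ P
    ⟦↑⟧ σ ρ P (suc x) rewrite lookup-map x weakenₜ σ = ⟦weaken⟧ (lookup σ x) ρ P

    -- Stated for any `T` so that the instance for renamings yields `⟦weaken⟧`, which the instance
    -- for terms needs under binders.
    ⟦/⟧-lift : (M : Tm m) (σ : Sub T m n) (ρ : Env n) →
               ⟦ M /ₜ σ ⟧ ρ ≃ ⟦ M ⟧ (λ x → ⟦ lift (lookup σ x) ⟧ ρ)
    ⟦/⟧-lift (var x) σ ρ = ≃-refl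
    ⟦/⟧-lift U       σ ρ = ≃-refl
    ⟦/⟧-lift (Π A B) σ ρ = ≃-refl
    ⟦/⟧-lift (ƛ A M) σ ρ =
      ƛ-cong {A = A /ₜ σ} {A} (M /ₜ σ ↑) M λ as →
        ≃-trans (⟦/⟧-lift M (σ ↑) (↑ as ◂ ρ)) (⟦ M ⟧-cong (⟦↑⟧ σ ρ (↑ as)))
    ⟦/⟧-lift (M · N) σ ρ =
      ·-cong (M /ₜ σ) (N /ₜ σ) M N (⟦/⟧-lift M σ ρ) (⟦/⟧-lift N σ ρ)

⟦weaken⟧ : (M : Tm n) (ρ : Env n) (P : Pred Ty 0ℓ) → ⟦ weaken M ⟧ (P ◂ ρ) ≃ ⟦ M ⟧ ρ
⟦weaken⟧ M ρ P = ≃-trans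
  (⟦/⟧-lift varLift (λ _ _ → ≃-refl) (λ _ _ _ → ≃-refl) M VarSubst.wk (P ◂ ρ))
  (⟦ M ⟧-cong λ x → ≡⇒≃ (cong (P ◂ ρ) (VarLemmas.lookup-wk x)))

⟦/⟧ : (M : Tm m) (σ : Sub Tm m n) (ρ : Env n) → ⟦ M / σ ⟧ ρ ≃ ⟦ M ⟧ (λ x → ⟦ lookup σ x ⟧ ρ)
⟦/⟧ = ⟦/⟧-lift termLift (λ _ _ → ≃-refl) ⟦weaken⟧

lookup-id : (x : Fin n) → lookup idₛ x ≡ var x
lookup-id zero    = refl
lookup-id (suc x) = trans (lookup-map x weaken idₛ)
  (trans (cong weaken (lookup-id x)) (cong var (VarLemmas.lookup-wk x)))

⟦[]⟧ : (M : Tm (suc n)) (N : Tm n) (ρ : Env n) → ⟦ M [ N ] ⟧ ρ ≃ ⟦ M ⟧ (⟦ N ⟧ ρ ◂ ρ)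
⟦[]⟧ M N ρ = ≃-trans (⟦/⟧ M (sub N) ρ)
  (⟦ M ⟧-cong λ { zero → ≃-refl ; (suc x) → ≡⇒≃ (cong (λ K → ⟦ K ⟧ ρ) (lookup-id x)) })

-- Right to left, continuity supplies the finite list of argument types.
⟦β⟧ : ∀ (A : Tm n) M N {ρ} → UpClosed ρ → ⟦ ƛ A M · N ⟧ ρ ≃ ⟦ M [ N ] ⟧ ρ
⟦β⟧ A M N {ρ} ρ-up = ≃-trans (to , from) (≃-sym (⟦[]⟧ M N ρ))
  where
  ↑⊆ : ∀ {P as} → P Respects _≤_ → All P as → ↑ as ⊆ P
  ↑⊆ P-up (p ∷ ps) (here a≤b) = P-up a≤b p
  ↑⊆ P-up (p ∷ ps) (there q)  = ↑⊆ P-up ps q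

  to : ⟦ ƛ A M · N ⟧ ρ ⊆ ⟦ M ⟧ (⟦ N ⟧ ρ ◂ ρ)
  to (as , p , ps) = ⟦ M ⟧-mono (◂-mono (↑⊆ (⟦ N ⟧-resp ρ-up) ps) λ _ → id) p

  from : ⟦ M ⟧ (⟦ N ⟧ ρ ◂ ρ) ⊆ ⟦ ƛ A M · N ⟧ ρ
  from p with F , F≈ρ , q ← ⟦ M ⟧-continuous p =
    F zero ,
    ⟦ M ⟧-mono (λ { zero → id ; (suc x) → ↑⊆ (ρ-up x) (F≈ρ (suc x)) }) q ,
    F≈ρ zero

-- Forwards, `d ≤ dom d ⇒ cod d`, which at `o` is `o ≤ [] ⇒ o`. Backwards, `as ⇒ cod d ≤ d` whenever
-- all of `as` lie in `↑ dom d`.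
⟦η⟧ : ∀ (A M : Tm n) {ρ} → UpClosed ρ → ⟦ M ⟧ ρ ≃ ⟦ ƛ A (weaken M · var zero) ⟧ ρ
⟦η⟧ A M {ρ} ρ-up = to , from
  where
  to : ⟦ M ⟧ ρ ⊆ ⟦ ƛ A (weaken M · var zero) ⟧ ρ
  to {d} p = dom d ,
    proj₂ (⟦weaken⟧ M ρ (↑ dom d)) (⟦ M ⟧-resp ρ-up (arr (⊆-↑ (dom d)) ≤-refl) p) ,
    ⊆-↑ (dom d)

  from : ⟦ ƛ A (weaken M · var zero) ⟧ ρ ⊆ ⟦ M ⟧ ρ
  from {d} (as , p , ps) =
    ⟦ M ⟧-resp ρ-up (arr ps ≤-refl) (proj₁ (⟦weaken⟧ M ρ (↑ dom d)) p)

-- Soundness of conversion and its consequences.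

soundness : ∀ {Γ : Ctx n} {A M N} → Γ ⊢ M ≐ N ∶ A → ∀ {ρ} → UpClosed ρ → ⟦ M ⟧ ρ ≃ ⟦ N ⟧ ρ
soundness (≐refl _)     ρ-up = ≃-refl
soundness (≐sym p)      ρ-up = ≃-sym (soundness p ρ-up)
soundness (≐trans p q)  ρ-up = ≃-trans (soundness p ρ-up) (soundness q ρ-up)
soundness (≐conv p _)   ρ-up = soundness p ρ-up
soundness (≐Π _ _)      ρ-up = ≃-refl
-- The bound variable denotes a principal filter, so the extended environment stays up-closed.
soundness (≐ƛ {A = A} {A′} {M = M} {M′} _ p) ρ-up =
  ƛ-cong {A = A} {A′} M M′ λ _ → soundness p (◂-upClosed ρ-up)
soundness (≐· {M = M} {M′} {N} {N′} p q) ρ-up =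
  ·-cong M N M′ N′ (soundness p ρ-up) (soundness q ρ-up)
soundness (≐β {A = A} {M = M} {N} _ _ _) ρ-up = ⟦β⟧ A M N ρ-up
soundness (≐η {A = A} {M = M} {N} _ _ p) ρ-up =
  -- Both sides are η-expanded, and the premise compares the bodies.
  ≃-trans (⟦η⟧ A M ρ-up)
    (≃-trans (ƛ-cong {A = A} {A} (weaken M · var zero) (weaken N · var zero)
               λ _ → soundness p (◂-upClosed ρ-up))
      (≃-sym (⟦η⟧ A N ρ-up)))

-- Up to a chain of conversions, each sound in the model, `T` is `U`.
⟦type-of-U⟧ : ∀ {Γ : Ctx n} {T ρ} → UpClosed ρ → Γ ⊢ U ∶ T → ⟦ U ⟧ ρ ≃ ⟦ T ⟧ ρ
⟦type-of-U⟧ ρ-up (⊢U _)      = ≃-refl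
⟦type-of-U⟧ ρ-up (⊢conv p q) = ≃-trans (⟦type-of-U⟧ ρ-up p) (soundness q ρ-up)

⟦type-of-Π⟧ : ∀ {Γ : Ctx n} {A B T ρ} → UpClosed ρ → Γ ⊢ Π A B ∶ T → ⟦ U ⟧ ρ ≃ ⟦ T ⟧ ρ
⟦type-of-Π⟧ ρ-up (⊢Π _ _)    = ≃-refl
⟦type-of-Π⟧ ρ-up (⊢conv p q) = ≃-trans (⟦type-of-Π⟧ ρ-up p) (soundness q ρ-up)

¬U∶Π : ∀ {Γ : Ctx n} {A B} → ¬ Γ ⊢ U ∶ Π A B
-- The empty sets are vacuously up-closed; `o` is an arbitrary element of the full set that would
-- have to lie in the empty one.
¬U∶Π p = proj₂ (⟦type-of-U⟧ {ρ = λ _ _ → ⊥} (λ _ _ ()) p) {o} tt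

¬Π∶Π : ∀ {Γ : Ctx n} {A B C D} → ¬ Γ ⊢ Π C D ∶ Π A B
¬Π∶Π p = proj₂ (⟦type-of-Π⟧ {ρ = λ _ _ → ⊥} (λ _ _ ()) p) {o} tt

theorem2p39 : (M A : Tm 0) → ∅ ⊢ M ∶ A →
    (∃₂ λ B N → M ≡ ƛ B N) ⊎ (∃₂ λ B C → M ≡ Π B C) ⊎ (M ≡ U) ⊎ (∃ λ M′ → M ⇝ M′)
theorem2p39 (var ()) A p
theorem2p39 U        A p = inj₂ (inj₂ (inj₁ refl))
theorem2p39 (Π B C)  A p = inj₂ (inj₁ (B , C , refl))
theorem2p39 (ƛ B N)  A p = inj₁ (B , N , refl)
-- Conversions are peeled off until `⊢·` exposes a product type for the function part.
theorem2p39 (M · N)  A (⊢conv p _) = theorem2p39 (M · N) _ p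
theorem2p39 (M · N)  _ (⊢· {A = A} {B} p _) with theorem2p39 M (Π A B) p
... | inj₁ (_ , _ , refl)          = inj₂ (inj₂ (inj₂ (_ , ⇝β)))
... | inj₂ (inj₁ (_ , _ , refl))   = ⊥-elim (¬Π∶Π p)
... | inj₂ (inj₂ (inj₁ refl))      = ⊥-elim (¬U∶Π p)
... | inj₂ (inj₂ (inj₂ (_ , M⇝M′))) = inj₂ (inj₂ (inj₂ (_ , ⇝· M⇝M′)))
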